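{- Assume Markov induction. Let $\chi:A\to\nabla_0B$ be an oracle, $P:\mathbb{N}\to\mathcal{U}$ a family of types, and $f:\prod_{n:\mathbb{N}}\bigcirc_\chi(P(n)+\neg P(n))$. Then $\neg\neg\,\bigcirc_\chi\left(\sum_{n:\mathbb{N}}P(n)\right)\to\bigcirc_\chi\left(\sum_{n:\mathbb{N}}P(n)\right)$.
   Context: Setting: homotopy type theory with a univalent universe $\mathcal{U}$ of small types and higher inductive types. It is assumed that there is a small type $\Omega_{\neg\neg}:\mathcal{U}$ classifying $\neg\neg$-stable propositions. For a type $X$, $\nabla_0X$ is the type of $\xi:X\to\Omega_{\neg\neg}$ such that $\neg\neg\sum_{x:X}\xi(x)$ and $\prod_{x,y:X}\xi(x)\to\xi(y)\to\neg\neg(x=y)$; write $\xi\downarrow:=\sum_{x:X}\xi(x)$ and $\xi\downarrow=x$ for $\xi(x)$. The nullification at a family $B:A\to\mathcal{U}$ is the higher modality whose modal types are exactly the $X$ with every constant map $X\to X^{B(a)}$ an equivalence. An oracle is a map $\chi:A\to\nabla_0B$; the oracle modality $\bigcirc_\chi$ is the nullification at $a\mapsto\chi(a)\downarrow$. Markov induction (MI): write $\mathtt{IsSuc}(\mu,\nu):=\prod_{m:\mathbb{N}}(\mu\downarrow=m)\to(\nu\downarrow=m+1)$ for $\mu,\nu:\nabla_0\mathbb{N}$; MI asserts that for every $P:\nabla_0\mathbb{N}\to\mathcal{U}$ and every $h:\prod_{\nu:\nabla_0\mathbb{N}}\left(\prod_{\mu:\nabla_0\mathbb{N}}\mathtt{IsSuc}(\mu,\nu)\to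 P(\mu)\right)\to P(\nu)$ there is a section $\prod_{\nu:\nabla_0\mathbb{N}}P(\nu)$. -}

{-# OPTIONS --without-K #-}
module Defs where

open import Data.Nat.Base using (ℕ; suc)
open import Data.Product.Base using (Σ; Σ-syntax; ∃; _×_; _,_; proj₁; proj₂)
open import Function.Base using (const)
open import Function.Bundles using (_⇔_)
open import Level using (Level; _⊔_)
open import Relation.Binary.PropositionalEquality.Core using (_≡_; refl)
open import Relation.Nullary using (¬_; Irrelevant; Stable)

-- The univalent universe 𝒰 is Set.  Univalence, the small classifier Ω¬¬ and the
-- nullification (a higher inductive type) are not available in this type theory, so
-- they are given as structures to be assumed; --without-K keeps univalence consistent.

private
  variable
    a b : Level

isContr : Set a → Set a
isContr X = Σ[ x ∈ X ] (∀ y → x ≡ y)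

isEquiv : {X : Set a} {Y : Set b} → (X → Y) → Set (a ⊔ b)
isEquiv {X = X} f = ∀ y → isContr (Σ[ x ∈ X ] f x ≡ y)

infix 4 _≃_

_≃_ : Set a → Set b → Set (a ⊔ b)
X ≃ Y = Σ[ f ∈ (X → Y) ] isEquiv f

id→equiv : {X Y : Set a} → X ≡ Y → X ≃ Y
id→equiv refl = (λ x → x) , λ y → (y , refl) , λ { (_ , refl) → refl }

Univalence : Set₁
Univalence = (X Y : Set) → isEquiv (id→equiv {X = X} {Y = Y})

-- Irrelevant P says that P is a proposition (any two elements are equal), and
-- Stable P is ¬ ¬ P → P.
StableProp : Set₁
StableProp = Σ[ P ∈ Set ] Irrelevant P × Stable P

record StablePropClassifier : Set₁ where
  field
    Ω¬¬      : Set
    classify : Ω¬¬ ≃ StableProp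

  ⟦_⟧ : Ω¬¬ → Set
  ⟦ p ⟧ = proj₁ (proj₁ classify p)

-- Higher modalities in the sense of Rijke, Shulman and Spitters.
record HigherModality : Set₁ where
  field
    ○        : Set → Set
    η        : {X : Set} → X → ○ X
    ○-ind    : {X : Set} (B : ○ X → Set) →
               ((x : X) → ○ (B (η x))) → (z : ○ X) → ○ (B z)
    ○-comp   : {X : Set} (B : ○ X → Set) (f : (x : X) → ○ (B (η x))) (x : X) →
               ○-ind B f (η x) ≡ f x
    ≡-modal  : {X : Set} (x y : ○ X) → isEquiv (η {x ≡ y})

  isModal : Set → Set
  isModal X = isEquiv (η {X})

isNull : {A : Set} (B : A → Set) → Set → Set
isNull {A} B X = (a : A) → isEquiv (λ (x : X) → const {B = B a} x)

-- The modal types determine a higher modality up to equivalence, so an element of this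
-- type is "the" nullification at B.
record Nullification {A : Set} (B : A → Set) : Set₁ where
  field
    modality   : HigherModality
  open HigherModality modality public
  field
    modal⇔null : (X : Set) → isModal X ⇔ isNull B X

module Oracles (C : StablePropClassifier) where
  open StablePropClassifier C

  ∇₀ : Set → Set
  ∇₀ X = Σ[ ξ ∈ (X → Ω¬¬) ]
           ¬ ¬ (Σ[ x ∈ X ] ⟦ ξ x ⟧) ×
           ((x y : X) → ⟦ ξ x ⟧ → ⟦ ξ y ⟧ → ¬ ¬ (x ≡ y))

  infix 4 _↓=_

  _↓=_ : {X : Set} → ∇₀ X → X → Set
  ξ ↓= x = ⟦ proj₁ ξ x ⟧

  _↓ : {X : Set} → ∇₀ X → Set
  ξ ↓ = ∃ (ξ ↓=_)

  IsSuc : ∇₀ ℕ → ∇₀ ℕ → Set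
  IsSuc μ ν = (m : ℕ) → μ ↓= m → ν ↓= suc m

  MarkovInduction : Set₁
  MarkovInduction =
    (P : ∇₀ ℕ → Set) →
    ((ν : ∇₀ ℕ) → ((μ : ∇₀ ℕ) → IsSuc μ ν → P μ) → P ν) →
    (ν : ∇₀ ℕ) → P ν

  OracleModality : {A B : Set} → (A → ∇₀ B) → Set₁
  OracleModality χ = Nullification (λ a → χ a ↓)

{-# OPTIONS --without-K #-}
module Submission where

-- As ⊥ is modal, ○ (Σ P) gives ¬¬ Σ P, so the least n with P n is ¬¬-defined, hence a
-- point of ∇₀ ℕ.  Markov induction runs over the distance ν from the current position k
-- to that point: deciding P k under ○ either ends the search, or shows that ν is not 0,
-- so that ν has a predecessor, the distance from k + 1.

open import Defs
open import Data.Empty using (⊥; ⊥-elim)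
open import Data.Nat.Base using (ℕ; zero; suc; _+_; _<_)
open import Data.Nat.Induction using (<-rec)
open import Data.Nat.Properties using (+-identityʳ; +-suc; suc-injective; <-cmp)
open import Data.Product.Base using (Σ-syntax; ∃; _×_; _,_; proj₁; proj₂)
open import Data.Sum.Base using (_⊎_; inj₁; inj₂)
open import Function.Base using (_∘_; id)
open import Function.Bundles using (Equivalence)
open import Relation.Binary.Definitions using (tri<; tri≈; tri>)
open import Relation.Binary.PropositionalEquality.Core using (_≡_; refl; sym; subst; cong)
open import Relation.Nullary using (¬_)
open import Relation.Nullary.Negation using (¬¬-map; negated-stable)

IsLeast : (ℕ → Set) → ℕ → Set
IsLeast P n = P n × (∀ m → m < n → ¬ P m)

¬¬-least : (P : ℕ → Set) → ¬ ¬ ∃ P → ¬ ¬ ∃ (IsLeast P)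
¬¬-least P ¬¬∃P ¬least = ¬¬∃P λ (n , p) → noneHolds n p
  where
  noneHolds : ∀ n → ¬ P n
  noneHolds = <-rec _ λ n below p → ¬least (n , p , λ m m<n → below m<n)

IsLeast-unique : (P : ℕ → Set) {m n : ℕ} → IsLeast P m → IsLeast P n → m ≡ n
IsLeast-unique P {m} {n} (pm , minm) (pn , minn) with <-cmp m n
... | tri< m<n _ _ = ⊥-elim (minn m m<n pm)
... | tri≈ _ m≡n _ = m≡n
... | tri> _ _ n<m = ⊥-elim (minm n n<m pn)

module _ (C : StablePropClassifier) where
  open StablePropClassifier C
  open Oracles C

  -- Irrelevance is refl because ⊥ is a record with η and an irrelevant field, so any two
  -- maps into it are definitionally equal; function extensionality is not needed.
  ¬¬-stableProp : Set → StableProp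
  ¬¬-stableProp X = (¬ ¬ X) , (λ _ _ → refl) , negated-stable

  code : Set → Ω¬¬
  code X = proj₁ (proj₁ (proj₂ classify (¬¬-stableProp X)))

  ⟦code⟧ : (X : Set) → ⟦ code X ⟧ ≡ (¬ ¬ X)
  ⟦code⟧ X = cong proj₁ (proj₂ (proj₁ (proj₂ classify (¬¬-stableProp X))))

  encode : {X : Set} → ¬ ¬ X → ⟦ code X ⟧
  encode {X} = subst id (sym (⟦code⟧ X))

  decode : {X : Set} → ⟦ code X ⟧ → ¬ ¬ X
  decode {X} = subst id (⟦code⟧ X)

  least : (P : ℕ → Set) → ¬ ¬ ∃ P → ∇₀ ℕ
  least P ¬¬∃P = code ∘ IsLeast P
    , ¬¬-map (λ (n , l) → n , encode (λ k → k l)) (¬¬-least P ¬¬∃P)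
    , λ x y lx ly ≢ → decode lx λ l → decode ly λ l′ → ≢ (IsLeast-unique P l l′)

  predecessor : (ν : ∇₀ ℕ) → ¬ (ν ↓= 0) → ∇₀ ℕ
  predecessor (ξ , ¬¬defined , unique) ν≠0 = ξ ∘ suc
    , ¬¬-map (λ { (zero , z) → ⊥-elim (ν≠0 z) ; (suc n , s) → n , s }) ¬¬defined
    , λ x y ξx ξy → ¬¬-map suc-injective (unique (suc x) (suc y) ξx ξy)

  module _ {A B : Set} (χ : A → ∇₀ B) (N : OracleModality χ) where
    open Nullification N

    ○-bind : {X Y : Set} → ○ X → (X → ○ Y) → ○ Y
    ○-bind {Y = Y} z f = ○-ind (λ _ → Y) f z

    ⊥-null : isNull (λ a → χ a ↓) ⊥
    ⊥-null a undefined = ⊥-elim (proj₁ (proj₂ (χ a)) undefined)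

    ○⊥-elim : ¬ ○ ⊥
    ○⊥-elim z = proj₁ (proj₁ (Equivalence.from (modal⇔null ⊥) ⊥-null z))

    ○⇒¬¬ : {X : Set} → ○ X → ¬ ¬ X
    ○⇒¬¬ z ¬x = ○⊥-elim (○-bind z (⊥-elim ∘ ¬x))

    search : MarkovInduction → (P : ℕ → Set) → ((n : ℕ) → ○ (P n ⊎ ¬ P n)) →
             (ν : ∇₀ ℕ) (k : ℕ) → (∀ n → ν ↓= n → ¬ ¬ P (n + k)) → ○ (∃ P)
    search MI P dec = MI _ λ ν rec k hit → ○-bind (dec k) λ
      { (inj₁ p)  → η (k , p)
      ; (inj₂ ¬p) →
          let μ = predecessor ν (λ ν=0 → hit 0 ν=0 ¬p) in
          rec μ (λ _ → id) (suc k) λ n μ=n →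
            subst (λ m → ¬ ¬ P m) (sym (+-suc n k)) (hit (suc n) μ=n)
      }

mainTheorem10 : Univalence →
    (C : StablePropClassifier) → let open Oracles C in
    MarkovInduction →
    (A B : Set) (χ : A → ∇₀ B)
    (N : OracleModality χ) → let open Nullification N in
    (P : ℕ → Set) →
    ((n : ℕ) → ○ (P n ⊎ ¬ P n)) →
    ¬ ¬ ○ (Σ[ n ∈ ℕ ] P n) → ○ (Σ[ n ∈ ℕ ] P n)
mainTheorem10 _ C MI A B χ N P dec ¬¬○∃P =
  search C χ N MI P dec (least C P ¬¬∃P) 0 λ n ν=n →
    subst (λ m → ¬ ¬ P m) (sym (+-identityʳ n)) (¬¬-map proj₁ (decode C ν=n))
  where
  ¬¬∃P : ¬ ¬ ∃ P
  ¬¬∃P ¬∃P = ¬¬○∃P λ z → ○⇒¬¬ C χ N z ¬∃P
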